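{- For all $n \in \mathbb{Z}^+$, there exists a universal cycle for $\mathcal{W}(n)$.
   Context: A weak order on $[n]=\{1,\dots,n\}$ is a relation that is transitive and complete. It is represented by the word $w = w_1w_2\ldots w_n$ in which $w_j$ is the height of element $j$, i.e. the number of symbols $\prec$ preceding $j$ when the weak order is written as a permutation of $[n]$ with consecutive symbols separated by $\equiv$ or $\prec$. Thus $\mathcal{W}(n)$ is identified with the set of all words $w_1w_2\ldots w_n$ of length $n$ over the nonnegative integers such that $\{w_1,\dots,w_n\} = \{0,1,\dots,h\}$ for some $h$ with $0 \le h \le n-1$. Let $\mathcal{C}$ be a set of $N$ strings, each of length $m$. A universal cycle (ucycle) for $\mathcal{C}$ is a word $a_0a_1\ldots a_{N-1}$ such that each $c \in \mathcal{C}$ appears exactly once as a subword $a_{i+1}a_{i+2}\ldots a_{i+m}$ (one value of $i$ modulo $N$), where subscripts are taken modulo $N$. (In particular every such subword is a string in $\mathcal{C}$.) -}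

module Defs where

open import Data.Fin using (Fin; toℕ)
open import Data.Fin.Properties using (nonZeroIndex)
open import Data.Nat using (ℕ; suc; _+_; _∸_; _≤_)
open import Data.Nat.DivMod using (_mod_)
open import Data.Product using (∃; ∃-syntax; ∃!; _×_)
open import Data.Vec using (Vec; lookup; tabulate)
open import Data.Vec.Membership.Propositional using (_∈_)
open import Data.Vec.Relation.Unary.Unique.Propositional using (Unique)
open import Function.Bundles using (_⇔_)
open import Level using (Level)
open import Relation.Binary.PropositionalEquality using (_≡_)
open import Relation.Unary using (Pred)

private
  variable
    a ℓ : Level
    A : Set a
    m N : ℕ

-- The set of words w₁…wₙ over ℕ with {w₁,…,wₙ} = {0,1,…,h} for some
-- 0 ≤ h ≤ n - 1; wⱼ is the height of the element j in the weak order.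
𝒲 : ∀ n → Pred (Vec ℕ n) _
𝒲 n w = ∃[ h ] (h ≤ n ∸ 1 × ∀ k → (k ∈ w) ⇔ (k ≤ h))

-- C, viewed as a subset of A, has exactly N elements.  They are listed without
-- repetition, so that the proofs of C x play no role in the count.
HasCardinality : {A : Set a} → Pred A ℓ → ℕ → Set _
HasCardinality {A = A} C N =
  ∃ λ (xs : Vec A N) → Unique xs × (∀ x → (x ∈ xs) ⇔ C x)

-- The subword aᵢ₊₁aᵢ₊₂…aᵢ₊ₘ of a₀a₁…a_{N-1}, subscripts modulo N; the entry
-- with index j, counted from 0, is aᵢ₊₁₊ⱼ.
window : ∀ m → Vec A N → Fin N → Vec A m
window {N = N} m as i =
  tabulate λ j → lookup as (_mod_ (suc (toℕ i + toℕ j)) N {{nonZeroIndex i}})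

-- The length N of the cycle is the number of strings in C.  As each string
-- occurs at exactly one of the N positions, counting shows that every window
-- is in C.
IsUCycle : {A : Set a} → Pred (Vec A m) ℓ → Vec A N → Set _
IsUCycle {m = m} {N = N} C as =
  HasCardinality C N × (∀ c → C c → ∃! _≡_ λ i → window m as i ≡ c)

{-# OPTIONS --safe #-}
-- Words are the edges of a graph on words one letter shorter, the word w going
-- from init w to tail w; a universal cycle amounts to an Eulerian circuit.  As
-- 𝒲 n is closed under rotation, its edges split into closed walks, the rotation
-- orbits.  The orbit of y can be spliced into a closed walk that is a union of
-- other orbits just after any x with tail x ≡ tail y.  All of 𝒲 n is collected
-- in this way starting from the orbit of 0…0: rotating a word until its greatest
-- letter comes first and then replacing that letter by 0 stays within 𝒲 n.
module Submission where

open import Defs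
open import Data.Nat using (ℕ; NonZero)
open import Data.Product using (∃)
open import Data.Vec using (Vec)

open import Data.Fin using (Fin; zero; suc; toℕ; fromℕ; inject₁)
open import Data.Fin.Properties using (toℕ-injective; toℕ-fromℕ; toℕ-fromℕ<; toℕ-inject₁; toℕ<n)
open import Data.Fin.Relation.Unary.Top using (view; ‵fromℕ; ‵inject₁)
open import Data.List as List using (List; []; _∷_; applyUpTo; cartesianProductWith; filter; length; upTo)
open import Data.List.Membership.Propositional using () renaming (_∈_ to _∈ₗ_)
open import Data.List.Membership.Propositional.Properties
  using (∈-++⁺ˡ; ∈-++⁺ʳ; ∈-++⁻; ∈-∃++; ∈-applyUpTo⁺; ∈-applyUpTo⁻; ∈-cartesianProductWith⁺; ∈-filter⁺; ∈-filter⁻; ∈-upTo⁺)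
open import Data.List.Properties using (∷-injectiveʳ; ++-assoc; ++-identityʳ)
open import Data.List.Relation.Binary.Disjoint.Propositional using (Disjoint)
open import Data.List.Relation.Binary.Permutation.Propositional using (_↭_; ↭-sym; ↭⇒↭ₛ)
open import Data.List.Relation.Binary.Permutation.Propositional.Properties using (∈-resp-↭; ++-comm; shifts)
open import Data.List.Relation.Binary.Permutation.Setoid.Properties using (Unique-resp-↭)
open import Data.List.Relation.Binary.Subset.Propositional using (_⊆_)
open import Data.List.Relation.Unary.All as All using (All; []; _∷_)
open import Data.List.Relation.Unary.AllPairs using ([]; _∷_)
open import Data.List.Relation.Unary.Any using (here; there)
open import Data.List.Relation.Unary.Unique.Propositional using () renaming (Unique to Uniqueₗ)
open import Data.List.Relation.Unary.Unique.Propositional.Properties using (applyUpTo⁺₁; ++⁺)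
open import Data.Nat using (zero; suc; _+_; _∸_; _≤_; _<_; z≤n; s≤s)
open import Data.Nat.DivMod using (_%_; _mod_; m%n<n; m<n⇒m%n≡m; m%n%n≡m%n; n%n≡0; %-distribˡ-+)
open import Data.Nat.GeneralisedArithmetic using (fold; fold-+)
open import Data.Nat.Induction using (<-rec)
open import Data.Nat.Properties hiding (_≟_)
import Data.Nat.Properties as ℕ
open import Data.Product using (∃₂; _×_; _,_; proj₁; proj₂; map₂)
open import Data.Sum using (_⊎_; inj₁; inj₂; [_,_]′)
open import Data.Vec as Vec using ([]; _∷_; _∷ʳ_; fromList; head; init; lookup; replicate; sum; tail; tabulate; toList)
open import Data.Vec.Membership.DecPropositional ℕ._≟_ using (_∈?_)
open import Data.Vec.Membership.Propositional using (_∈_)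
open import Data.Vec.Membership.Propositional.Properties using (∈-fromList⁺; ∈-fromList⁻; ∈-lookup; ∈-toList⁺; ∈-toList⁻)
open import Data.Vec.Properties
  using (init-∷ʳ; lookup-map; tabulate-cong; tabulate∘lookup; toList-∷ʳ; toList-injective; cast-is-id; ≡-dec)
open import Data.Vec.Relation.Unary.All as VecAll using ()
open import Data.Vec.Relation.Unary.All.Properties using () renaming (fromList⁺ to All-fromList⁺; lookup⁻ to All-lookup⁻)
import Data.Vec.Relation.Unary.AllPairs as VecPairs
open import Data.Vec.Relation.Unary.Any as VecAny using ()
open import Data.Vec.Relation.Unary.Any.Properties using (lookup-index)
open import Data.Vec.Relation.Unary.Unique.Propositional using (Unique)
open import Data.Vec.Relation.Unary.Unique.Propositional.Properties using (lookup-injective)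
open import Function using (_∘_; _⇔_; mk⇔; Equivalence; case_of_)
open import Relation.Binary.Definitions using (DecidableEquality)
open import Relation.Binary.PropositionalEquality
open import Relation.Nullary using (yes; no; contradiction)
open import Relation.Nullary.Decidable using (map′; _×-dec_)
open import Relation.Unary using (Pred; Decidable)

fold-suc : ∀ {X : Set} (x : X) f n → fold x f (suc n) ≡ fold (f x) f n
fold-suc x f zero    = refl
fold-suc x f (suc n) = cong f (fold-suc x f n)

-- Closed walks spliced together from the orbits of an edge map.

module Orbits {X V : Set} (_≟_ : DecidableEquality X) (src tgt : X → V) (f : X → X)
  (src∘f : ∀ x → src (f x) ≡ tgt x)
  (periodic : ∀ x → ∃ λ d → 0 < d × fold x f d ≡ x) where

  open import Data.List.Membership.DecPropositional _≟_ using () renaming (_∈?_ to _∈ₗ?_)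

  -- Endpoints are matched through equations, since `src x` and `tgt x` are values of arbitrary
  -- functions, with which indices do not unify.
  data Walk (u v : V) : List X → Set where
    []  : u ≡ v → Walk u v []
    _∷_ : ∀ {x xs} → src x ≡ u → Walk (tgt x) v xs → Walk u v (x ∷ xs)

  walk-++ : ∀ {u v w xs ys} → Walk u v xs → Walk v w ys → Walk u w (xs List.++ ys)
  walk-++ ([] refl) q = q
  walk-++ (e ∷ p)   q = e ∷ walk-++ p q

  -- After the edge `x` the walk stands at `tgt x`, so a detour that starts and ends there fits in
  -- before the walk resumes.
  splice : ∀ {u v x ys zs} xs → Walk u v (xs List.++ x ∷ ys) → Walk (tgt x) (tgt x) zs →
           Walk u v (xs List.++ x ∷ zs List.++ ys)
  splice []       (e ∷ p) q = e ∷ walk-++ q p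
  splice (_ ∷ xs) (e ∷ p) q = e ∷ splice xs p q

  applyUpTo-walk : ∀ (g : ℕ → X) d → (∀ i → src (g (suc i)) ≡ tgt (g i)) →
                   Walk (tgt (g 0)) (tgt (g d)) (applyUpTo (g ∘ suc) d)
  applyUpTo-walk g zero    e = [] refl
  applyUpTo-walk g (suc d) e = e 0 ∷ applyUpTo-walk (g ∘ suc) d (e ∘ suc)

  Minimal : X → ℕ → Set
  Minimal x d = ∀ {e} → 0 < e → e < d → fold x f e ≢ x

  -- Only the least period keeps the list of an orbit free of repetitions. It is found by descent: a
  -- bounded search either yields a smaller positive period or shows that there is none.
  minimal-period : ∀ x → ∃ λ d → 0 < d × fold x f d ≡ x × Minimal x d
  minimal-period x = let d , 0<d , eq = periodic x in <-rec Q step d 0<d eq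
    where
    Q : ℕ → Set
    Q d = 0 < d → fold x f d ≡ x → ∃ λ d → 0 < d × fold x f d ≡ x × Minimal x d

    step : ∀ d → (∀ {e} → e < d → Q e) → Q d
    step d rec 0<d eq with anyUpTo? (λ e → (1 ≤? e) ×-dec (fold x f e ≟ x)) d
    ... | yes (e , e<d , 0<e , eq′) = rec e<d 0<e eq′
    ... | no  none = d , 0<d , eq , λ 0<e e<d eq′ → none (_ , e<d , 0<e , eq′)

  period : X → ℕ
  period x = proj₁ (minimal-period x)

  fold-period : ∀ x → fold x f (period x) ≡ x
  fold-period x = proj₁ (proj₂ (proj₂ (minimal-period x)))

  -- Completing the period undoes the first `i` steps, so `x` can be regained from every point of
  -- its orbit without an inverse of `f`.
  return : ∀ x {i} → i ≤ period x → fold (fold x f i) f (period x ∸ i) ≡ x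
  return x {i} i≤d = begin
    fold (fold x f i) f (period x ∸ i) ≡⟨ fold-+ x f (period x ∸ i) ⟨
    fold x f (period x ∸ i + i)        ≡⟨ cong (fold x f) (m∸n+n≡m i≤d) ⟩
    fold x f (period x)                ≡⟨ fold-period x ⟩
    x                                  ∎
    where open ≡-Reasoning

  -- The list runs from `f x` round to `x`, so that as a walk it leaves from and returns to `tgt x`,
  -- the vertex at which `splice` inserts it.
  orbit : X → List X
  orbit x = applyUpTo (fold x f ∘ suc) (period x)

  orbit-walk : ∀ x → Walk (tgt x) (tgt x) (orbit x)
  orbit-walk x = subst (λ y → Walk (tgt x) (tgt y) (orbit x)) (fold-period x)
    (applyUpTo-walk (fold x f) (period x) (λ i → src∘f _))

  -- A coincidence at steps `suc i` and `suc j` with `i < j` persists after `period x ∸ suc j` more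
  -- steps. These take the later point back to `x`, so the earlier one yields a positive period
  -- below the least.
  orbit-unique : ∀ x → Uniqueₗ (orbit x)
  orbit-unique x = applyUpTo⁺₁ _ (period x) λ {i} {j} i<j j<d eq →
    proj₂ (proj₂ (proj₂ (minimal-period x)))
      (<-≤-trans (s≤s z≤n) (m≤n+m (suc i) (period x ∸ suc j)))
      (subst (period x ∸ suc j + suc i <_) (m∸n+n≡m j<d)
        (+-monoʳ-< (period x ∸ suc j) (s≤s i<j)))
      (begin
        fold x f (period x ∸ suc j + suc i)          ≡⟨ fold-+ x f (period x ∸ suc j) ⟩
        fold (fold x f (suc i)) f (period x ∸ suc j) ≡⟨ cong (λ y → fold y f (period x ∸ suc j)) eq ⟩
        fold (fold x f (suc j)) f (period x ∸ suc j) ≡⟨ return x j<d ⟩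
        x                                            ∎)
    where open ≡-Reasoning

  self∈orbit : ∀ x → x ∈ₗ orbit x
  self∈orbit x with minimal-period x
  ... | suc d , _ , eq , _ = subst (_∈ₗ applyUpTo (fold x f ∘ suc) (suc d)) eq (∈-applyUpTo⁺ (fold x f ∘ suc) (n<1+n d))

  f-orbit : ∀ x {y} → y ∈ₗ orbit x → f y ∈ₗ orbit x
  f-orbit x y∈ with ∈-applyUpTo⁻ (fold x f ∘ suc) y∈
  ... | i , i<d , refl with m≤n⇒m<n∨m≡n i<d
  ...   | inj₁ 1+i<d = ∈-applyUpTo⁺ (fold x f ∘ suc) 1+i<d
  -- The last entry of the list is `x` itself, and its image wraps around to the first entry `f x`.
  ...   | inj₂ 1+i≡d = subst (_∈ₗ orbit x)
          (cong f (sym (trans (cong (fold x f) 1+i≡d) (fold-period x))))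
          (∈-applyUpTo⁺ (fold x f ∘ suc) (≤-<-trans z≤n i<d))

  fold-closed : ∀ {ℓ} (P : Pred X ℓ) → (∀ {x} → P x → P (f x)) → ∀ {x} n → P x → P (fold x f n)
  fold-closed P step zero    p = p
  fold-closed P step (suc n) p = step (fold-closed P step n p)

  module _ (P : X → Set) (b : X) where

    -- A derivation prescribes an order in which orbits can be collected. `branch` demands `P y`,
    -- because a shared target alone does not put `y` in `P`.
    data Reachable : X → Set where
      base   : Reachable b
      rotate : ∀ {x} → Reachable x → Reachable (f x)
      branch : ∀ {x y} → P y → tgt x ≡ tgt y → Reachable x → Reachable y

    -- `f-closed` makes the edges a union of whole orbits, so a further orbit is either contained in
    -- them or disjoint from them. `base∈` gives every derivation of reachability its starting
    -- point.
    record Trail : Set where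
      field
        {vertex} : V
        edges    : List X
        closed   : Walk vertex vertex edges
        unique   : Uniqueₗ edges
        f-closed : ∀ {x} → x ∈ₗ edges → f x ∈ₗ edges
        base∈    : b ∈ₗ edges
        sound    : ∀ {x} → x ∈ₗ edges → Reachable x

    open Trail

    orbit-reachable : ∀ {x y} → Reachable x → y ∈ₗ orbit x → Reachable y
    orbit-reachable {x} r y∈ with ∈-applyUpTo⁻ (fold x f ∘ suc) y∈
    ... | i , _ , refl = fold-closed Reachable rotate (suc i) r

    -- By induction on the derivation: the base edge is present already, and a rotated edge is
    -- present as soon as the edge before it is. Only a branch to a missing `y` calls for splicing,
    -- and the orbit of `y` then goes in just after `x`.
    extend : ∀ {y} (T : Trail) → Reachable y → ∃ λ T′ → edges T ⊆ edges T′ × y ∈ₗ edges T′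
    extend T base       = T , (λ z∈ → z∈) , base∈ T
    extend T (rotate r) = map₂ (λ {T′} → map₂ (f-closed T′)) (extend T r)
    extend {y} T r′@(branch _ eq r) with extend T r
    ... | T′ , T⊆T′ , x∈ with y ∈ₗ? edges T′
    ...   | yes y∈ = T′ , T⊆T′ , y∈
    ...   | no  y∉ with ∈-∃++ x∈
    ...     | as , bs , split = T″ , to ∘ ∈-++⁺ʳ (orbit y) ∘ T⊆T′ , to (∈-++⁺ˡ (self∈orbit y))
      where
      new : List X
      new = as List.++ _ ∷ orbit y List.++ bs

      -- Up to order the new list is the orbit followed by the old trail; membership and uniqueness
      -- are settled there and carried over.
      perm : orbit y List.++ edges T′ ↭ new
      perm = ↭-sym (subst (λ es → new ↭ orbit y List.++ es) (sym split)
        (subst₂ _↭_ (++-assoc as (_ ∷ []) (orbit y List.++ bs))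
          (cong (orbit y List.++_) (++-assoc as (_ ∷ []) bs))
          (shifts (as List.++ _ ∷ []) (orbit y))))

      to : ∀ {z} → z ∈ₗ orbit y List.++ edges T′ → z ∈ₗ new
      to = ∈-resp-↭ perm

      from : ∀ {z} → z ∈ₗ new → z ∈ₗ orbit y ⊎ z ∈ₗ edges T′
      from = ∈-++⁻ (orbit y) ∘ ∈-resp-↭ (↭-sym perm)

      disjoint : Disjoint (orbit y) (edges T′)
      disjoint (z∈o , z∈T) with ∈-applyUpTo⁻ (fold y f ∘ suc) z∈o
      -- A common edge, moved on along its orbit, would reach `y` without leaving the trail.
      ... | i , i<d , refl = y∉ (subst (_∈ₗ edges T′) (return y i<d)
            (fold-closed (_∈ₗ edges T′) (f-closed T′) (period y ∸ suc i) z∈T))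

      T″ : Trail
      T″ = record
        { edges    = new
        ; closed   = splice as (subst (Walk _ _) split (closed T′))
                       -- The shared target turns the closed walk at `tgt y` into one at `tgt x`.
                       (subst (λ v → Walk v v (orbit y)) (sym eq) (orbit-walk y))
        ; unique   = Unique-resp-↭ (setoid X) (↭⇒↭ₛ perm) (++⁺ (orbit-unique y) (unique T′) disjoint)
        ; f-closed = to ∘ [ ∈-++⁺ˡ ∘ f-orbit y , ∈-++⁺ʳ (orbit y) ∘ f-closed T′ ]′ ∘ from
        ; base∈    = to (∈-++⁺ʳ (orbit y) (base∈ T′))
        ; sound    = [ orbit-reachable r′ , sound T′ ]′ ∘ from
        }

    -- Edges are added one at a time; those covered earlier stay covered, since `extend` never loses
    -- an edge.
    covering-trail : ∀ {ys} → All Reachable ys → ∃ λ T → All (_∈ₗ edges T) ys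
    covering-trail [] = T₀ , []
      where
      T₀ : Trail
      T₀ = record
        { edges    = orbit b
        ; closed   = orbit-walk b
        ; unique   = orbit-unique b
        ; f-closed = f-orbit b
        ; base∈    = self∈orbit b
        ; sound    = orbit-reachable base
        }
    covering-trail (r ∷ rs) =
      let T , covers = covering-trail rs
          T′ , T⊆T′ , y∈ = extend T r
      in T′ , y∈ ∷ All.map T⊆T′ covers

  walk-first : ∀ {u v x xs} → Walk u v (x ∷ xs) → src x ≡ u
  walk-first (e ∷ _) = e

  walk-last : ∀ {u v x xs} → Walk u v (x ∷ xs) → tgt (lookup (fromList (x ∷ xs)) (fromℕ (length xs))) ≡ v
  walk-last {xs = []}    (_ ∷ [] e) = e
  walk-last {xs = _ ∷ _} (_ ∷ p)    = walk-last p

  walk-step : ∀ {u v x xs} → Walk u v (x ∷ xs) → ∀ j →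
              tgt (lookup (fromList (x ∷ xs)) (inject₁ j)) ≡ src (lookup (fromList (x ∷ xs)) (suc j))
  walk-step {xs = _ ∷ _} (_ ∷ e ∷ _) zero    = sym e
  walk-step {xs = _ ∷ _} (_ ∷ p)     (suc j) = walk-step p j


-- The cyclic successor of an index.

next : ∀ {p} → Fin (suc p) → Fin (suc p)
next {p} i = suc (toℕ i) mod suc p

next-fromℕ : ∀ p → next (fromℕ p) ≡ zero
next-fromℕ p = toℕ-injective (trans (toℕ-fromℕ< (m%n<n (suc (toℕ (fromℕ p))) (suc p)))
  (trans (cong (λ k → suc k % suc p) (toℕ-fromℕ p)) (n%n≡0 (suc p))))

next-inject₁ : ∀ {p} (j : Fin p) → next (inject₁ j) ≡ suc j
next-inject₁ {p} j = toℕ-injective (trans (toℕ-fromℕ< (m%n<n (suc (toℕ (inject₁ j))) (suc p)))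
  (trans (cong (λ k → suc k % suc p) (toℕ-inject₁ j)) (m<n⇒m%n≡m (s≤s (toℕ<n j)))))

next-injective : ∀ {p} (i j : Fin (suc p)) → next i ≡ next j → i ≡ j
next-injective {p} i j eq with view i | view j
... | ‵fromℕ     | ‵fromℕ     = refl
... | ‵fromℕ     | ‵inject₁ b = case trans (sym (next-fromℕ p)) (trans eq (next-inject₁ b)) of λ ()
... | ‵inject₁ a | ‵fromℕ     = case trans (sym (next-inject₁ a)) (trans eq (next-fromℕ p)) of λ ()
... | ‵inject₁ a | ‵inject₁ b = case trans (sym (next-inject₁ a)) (trans eq (next-inject₁ b)) of λ where
  refl → refl

next-surjective : ∀ {p} (i : Fin (suc p)) → ∃ λ j → next j ≡ i
next-surjective zero    = fromℕ _ , next-fromℕ _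
next-surjective (suc i) = inject₁ i , next-inject₁ i

next-mod : ∀ {p} k → next (k mod suc p) ≡ suc k mod suc p
next-mod {p} k = toℕ-injective (begin
  toℕ (next (k mod N))    ≡⟨ toℕ-fromℕ< (m%n<n (suc (toℕ (k mod N))) N) ⟩
  suc (toℕ (k mod N)) % N ≡⟨ cong (λ l → suc l % N) (toℕ-fromℕ< (m%n<n k N)) ⟩
  suc (k % N) % N         ≡⟨ %-distribˡ-+ 1 (k % N) N ⟩
  (1 % N + k % N % N) % N ≡⟨ cong (λ l → (1 % N + l) % N) (m%n%n≡m%n k N) ⟩
  (1 % N + k % N) % N     ≡⟨ %-distribˡ-+ 1 k N ⟨
  suc k % N               ≡⟨ toℕ-fromℕ< (m%n<n (suc k) N) ⟨
  toℕ (suc k mod N)       ∎)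
  where
  open ≡-Reasoning
  N = suc p

-- Cyclic lists of overlapping words and their windows.

module _ {A : Set} where

  lookup-∷ʳ-inject₁ : ∀ {n} (xs : Vec A n) x j → lookup (xs ∷ʳ x) (inject₁ j) ≡ lookup xs j
  lookup-∷ʳ-inject₁ (_ ∷ _)  x zero    = refl
  lookup-∷ʳ-inject₁ (_ ∷ xs) x (suc j) = lookup-∷ʳ-inject₁ xs x j

  lookup-init : ∀ {n} (xs : Vec A (suc n)) j → lookup (init xs) j ≡ lookup xs (inject₁ j)
  lookup-init xs j with Vec.initLast xs
  ... | ys , y , refl = sym (lookup-∷ʳ-inject₁ ys y j)

  lookup-zero : ∀ {n} (xs : Vec A (suc n)) → lookup xs zero ≡ head xs
  lookup-zero (_ ∷ _) = refl

  lookup-tail : ∀ {n} (xs : Vec A (suc n)) j → lookup xs (suc j) ≡ lookup (tail xs) j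
  lookup-tail (_ ∷ _) j = refl

  module _ {m p} (xs : Vec (Vec A (suc m)) (suc p))
    (consecutive : ∀ i → tail (lookup xs i) ≡ init (lookup xs (next i))) where

    -- By the overlap, entry `suc j` of one word is entry `j` of the following word, so moving on by
    -- `l` words brings entry `l` to the head. The recursion is on the number `l`, as `inject₁ j` is
    -- not a subterm of `suc j`.
    consecutive-entry : ∀ l k (j : Fin (suc m)) → toℕ j ≡ l →
                    lookup (lookup xs (k mod suc p)) j ≡ head (lookup xs ((k + l) mod suc p))
    consecutive-entry zero    k zero    refl = trans (lookup-zero (lookup xs (k mod suc p)))
      (cong (λ l → head (lookup xs (l mod suc p))) (sym (+-identityʳ k)))
    consecutive-entry (suc l) k (suc j) eq   = begin
      lookup (lookup xs (k mod N)) (suc j)            ≡⟨ lookup-tail (lookup xs (k mod N)) j ⟩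
      lookup (tail (lookup xs (k mod N))) j           ≡⟨ cong (λ v → lookup v j) (consecutive (k mod N)) ⟩
      lookup (init (lookup xs (next (k mod N)))) j    ≡⟨ lookup-init _ j ⟩
      lookup (lookup xs (next (k mod N))) (inject₁ j) ≡⟨ cong (λ i → lookup (lookup xs i) (inject₁ j)) (next-mod k) ⟩
      lookup (lookup xs (suc k mod N)) (inject₁ j)    ≡⟨ consecutive-entry l (suc k) (inject₁ j) (trans (toℕ-inject₁ j) (suc-injective eq)) ⟩
      head (lookup xs ((suc k + l) mod N))            ≡⟨ cong (λ q → head (lookup xs (q mod N))) (+-suc k l) ⟨
      head (lookup xs ((k + suc l) mod N))            ∎
      where
      open ≡-Reasoning
      N = suc p

    -- A window starts one place after its index, whence `next i` rather than `i`.
    window-heads : ∀ i → window (suc m) (Vec.map head xs) i ≡ lookup xs (next i)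
    window-heads i = trans
      (tabulate-cong λ j → trans (lookup-map _ head xs) (sym (consecutive-entry (toℕ j) (suc (toℕ i)) j refl)))
      (tabulate∘lookup (lookup xs (next i)))

fromList-unique : ∀ {A : Set} {xs : List A} → Uniqueₗ xs → Unique (fromList xs)
fromList-unique []       = VecPairs.[]
fromList-unique (p ∷ ps) = All-fromList⁺ p VecPairs.∷ fromList-unique ps

-- The windows of the heads are the words of the list, and `next` permutes the indices, so positions
-- correspond one to one to the entries of a list without repetitions.
ucycle-from-heads : ∀ {A : Set} {m p} {C : Vec A (suc m) → Set} (xs : Vec (Vec A (suc m)) (suc p)) →
  Unique xs → (∀ x → (x ∈ xs) ⇔ C x) →
  (∀ i → tail (lookup xs i) ≡ init (lookup xs (next i))) →
  IsUCycle C (Vec.map head xs)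
ucycle-from-heads {m = m} xs unique enumerates consecutive = (xs , unique , enumerates) , λ c Cc →
  let c∈xs    = Equivalence.from (enumerates c) Cc
      -- The window at `i` is the entry at `next i`, so the position sought is the cyclic
      -- predecessor of the index of `c`.
      i , i≡  = next-surjective (VecAny.index c∈xs)
      at-i    = trans (window-heads xs consecutive i) (trans (cong (lookup xs) i≡) (sym (lookup-index c∈xs)))
  in i , at-i , λ {j} at-j → next-injective i j (lookup-injective unique _ _
       (trans (sym (window-heads xs consecutive i)) (trans at-i (trans (sym at-j) (window-heads xs consecutive j)))))

-- Rotations

-- On lists a word can be split in two without matching its length to a sum, so rotation by several
-- places is computed here and transported to vectors.
rotateₗ : ∀ {A : Set} → List A → List A
rotateₗ []       = []
rotateₗ (x ∷ xs) = xs List.++ x ∷ []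

rotateₗ-++ : ∀ {A : Set} (xs ys : List A) → fold (xs List.++ ys) rotateₗ (length xs) ≡ ys List.++ xs
rotateₗ-++ []       ys = sym (++-identityʳ ys)
rotateₗ-++ (x ∷ xs) ys = begin
  fold (x ∷ xs List.++ ys) rotateₗ (suc (length xs))        ≡⟨ fold-suc (x ∷ xs List.++ ys) rotateₗ (length xs) ⟩
  fold ((xs List.++ ys) List.++ x ∷ []) rotateₗ (length xs) ≡⟨ cong (λ zs → fold zs rotateₗ (length xs)) (++-assoc xs ys (x ∷ [])) ⟩
  fold (xs List.++ ys List.++ x ∷ []) rotateₗ (length xs)   ≡⟨ rotateₗ-++ xs (ys List.++ x ∷ []) ⟩
  (ys List.++ x ∷ []) List.++ xs                            ≡⟨ ++-assoc ys (x ∷ []) xs ⟩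
  ys List.++ x ∷ xs                                         ∎
  where open ≡-Reasoning

rot : ∀ {A : Set} {m} → Vec A (suc m) → Vec A (suc m)
rot (x ∷ xs) = xs ∷ʳ x

-- This makes rotation orbits walks: the edge `rot v` leaves from the vertex at which `v` arrives.
init-rot : ∀ {A : Set} {m} (v : Vec A (suc m)) → init (rot v) ≡ tail v
init-rot (x ∷ xs) = init-∷ʳ x xs

toList-rot : ∀ {A : Set} {m} (v : Vec A (suc m)) k → toList (fold v rot k) ≡ fold (toList v) rotateₗ k
toList-rot v zero    = refl
toList-rot v (suc k) = trans (step (fold v rot k)) (cong rotateₗ (toList-rot v k))
  where
  step : ∀ {A : Set} {m} (v : Vec A (suc m)) → toList (rot v) ≡ rotateₗ (toList v)
  step (x ∷ xs) = toList-∷ʳ x xs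

toList-injective′ : ∀ {A : Set} {m} (v w : Vec A m) → toList v ≡ toList w → v ≡ w
toList-injective′ v w eq = trans (sym (cast-is-id refl v)) (toList-injective refl v w eq)

rot-periodic : ∀ {A : Set} {m} (v : Vec A (suc m)) → ∃ λ d → 0 < d × fold v rot d ≡ v
rot-periodic v@(_ ∷ _) = length (toList v) , s≤s z≤n , toList-injective′ _ v (begin
  toList (fold v rot (length (toList v)))                ≡⟨ toList-rot v (length (toList v)) ⟩
  fold (toList v) rotateₗ (length (toList v))            ≡⟨ cong (λ l → fold l rotateₗ (length (toList v))) (++-identityʳ (toList v)) ⟨
  fold (toList v List.++ []) rotateₗ (length (toList v)) ≡⟨ rotateₗ-++ (toList v) [] ⟩
  toList v                                               ∎)
  where open ≡-Reasoning

-- If `v` is `as` followed by `a ∷ bs`, rotating off `as` puts `a` first, and rotating off `a ∷ bs`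
-- then restores `v`. Only this second rotation is recorded, as reachability propagates from `a ∷ u`
-- to `v`.
rotate-to-front : ∀ {A : Set} {m} {a} (v : Vec A (suc m)) → a ∈ v → ∃₂ λ u k → fold (a ∷ u) rot k ≡ v
rotate-to-front {a = a} v a∈v with ∈-∃++ (∈-toList⁺ a∈v)
... | as , bs , split with fold v rot (length as) in eq
...   | z ∷ u = u , length (a ∷ bs) , toList-injective′ _ v (begin
  toList (fold (a ∷ u) rot (length (a ∷ bs)))          ≡⟨ toList-rot (a ∷ u) (length (a ∷ bs)) ⟩
  fold (toList (a ∷ u)) rotateₗ (length (a ∷ bs))      ≡⟨ cong (λ l → fold l rotateₗ (length (a ∷ bs))) front ⟩
  fold ((a ∷ bs) List.++ as) rotateₗ (length (a ∷ bs)) ≡⟨ rotateₗ-++ (a ∷ bs) as ⟩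
  as List.++ a ∷ bs                                    ≡⟨ split ⟨
  toList v                                             ∎)
  where
  open ≡-Reasoning
  front′ : toList (z ∷ u) ≡ a ∷ bs List.++ as
  front′ = begin
    toList (z ∷ u)                               ≡⟨ cong toList eq ⟨
    toList (fold v rot (length as))              ≡⟨ toList-rot v (length as) ⟩
    fold (toList v) rotateₗ (length as)          ≡⟨ cong (λ l → fold l rotateₗ (length as)) split ⟩
    fold (as List.++ a ∷ bs) rotateₗ (length as) ≡⟨ rotateₗ-++ as (a ∷ bs) ⟩
    a ∷ bs List.++ as                            ∎
  front : toList (a ∷ u) ≡ a ∷ bs List.++ as
  front = cong (a ∷_) (∷-injectiveʳ front′)

∈-rot⁺ : ∀ {A : Set} {m} {a : A} (v : Vec A (suc m)) → a ∈ v → a ∈ rot v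
∈-rot⁺ (x ∷ xs) a∈ = ∈-toList⁻ (subst (_ ∈ₗ_) (sym (toList-∷ʳ x xs))
  (∈-resp-↭ (++-comm (x ∷ []) (toList xs)) (∈-toList⁺ a∈)))

∈-rot⁻ : ∀ {A : Set} {m} {a : A} (v : Vec A (suc m)) → a ∈ rot v → a ∈ v
∈-rot⁻ (x ∷ xs) a∈ = ∈-toList⁻ (∈-resp-↭ (++-comm (toList xs) (x ∷ []))
  (subst (_ ∈ₗ_) (toList-∷ʳ x xs) (∈-toList⁺ a∈)))

∈-fold-rot⁻ : ∀ {A : Set} {m} {a : A} (v : Vec A (suc m)) k → a ∈ fold v rot k → a ∈ v
∈-fold-rot⁻ v zero    a∈ = a∈
∈-fold-rot⁻ v (suc k) a∈ = ∈-fold-rot⁻ v k (∈-rot⁻ _ a∈)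

∈-fold-rot⁺ : ∀ {A : Set} {m} {a : A} (v : Vec A (suc m)) k → a ∈ v → a ∈ fold v rot k
∈-fold-rot⁺ v zero    a∈ = a∈
∈-fold-rot⁺ v (suc k) a∈ = ∈-rot⁺ _ (∈-fold-rot⁺ v k a∈)

sum-∷ʳ : ∀ {m} (xs : Vec ℕ m) x → sum (xs ∷ʳ x) ≡ x + sum xs
sum-∷ʳ []       x = refl
sum-∷ʳ (y ∷ xs) x = begin
  y + sum (xs ∷ʳ x) ≡⟨ cong (y +_) (sum-∷ʳ xs x) ⟩
  y + (x + sum xs)  ≡⟨ x∙yz≈y∙xz y x (sum xs) ⟩
  x + (y + sum xs)  ∎
  where
  open ≡-Reasoning
  open import Algebra.Properties.CommutativeSemigroup +-commutativeSemigroup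

-- The letter sum will be the induction measure, and it must survive bringing a letter to the front.
sum-fold-rot : ∀ {m} (v : Vec ℕ (suc m)) k → sum (fold v rot k) ≡ sum v
sum-fold-rot v zero    = refl
sum-fold-rot v (suc k) = trans (step (fold v rot k)) (sum-fold-rot v k)
  where
  step : ∀ {m} (v : Vec ℕ (suc m)) → sum (rot v) ≡ sum v
  step (x ∷ xs) = sum-∷ʳ xs x

-- Heights of weak orders

HasHeight : ∀ {n} → Vec ℕ n → ℕ → Set
HasHeight w h = ∀ k → (k ∈ w) ⇔ (k ≤ h)

-- The quantifier over all `k` reduces to two finite checks: every letter is at most `h`, and every
-- number below `suc h` occurs.
hasHeight? : ∀ {n} (w : Vec ℕ n) → Decidable (HasHeight w)
hasHeight? w h = map′
  (λ (bounded , full) k → mk⇔ (λ k∈ → VecAll.lookup bounded k∈) (λ k≤h → full (s≤s k≤h)))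
  (λ height → All-lookup⁻ (λ i → Equivalence.to (height _) (∈-lookup i w))
            , λ { (s≤s k≤h) → Equivalence.from (height _) k≤h })
  (VecAll.all? (_≤? h) w ×-dec allUpTo? (_∈? w) (suc h))

𝒲? : ∀ {m} → Decidable (𝒲 (suc m))
𝒲? {m} w = map′ (λ { (h , s≤s h≤m , height) → h , h≤m , height })
                (λ { (h , h≤m , height) → h , s≤s h≤m , height })
                (anyUpTo? (hasHeight? w) (suc m))

words : ℕ → ∀ m → List (Vec ℕ m)
words b zero    = [] ∷ []
words b (suc m) = cartesianProductWith _∷_ (upTo b) (words b m)

∈-words : ∀ {b m} (w : Vec ℕ m) → (∀ {k} → k ∈ w → k < b) → w ∈ₗ words b m
∈-words []      bound = here refl
∈-words (x ∷ w) bound = ∈-cartesianProductWith⁺ _∷_ (∈-upTo⁺ (bound (VecAny.here refl)))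
  (∈-words w (bound ∘ VecAny.there))

-- Heights are at most `m`, so letters below `suc m` suffice to find every word of `𝒲 (suc m)` by a
-- finite search.
enumeration : ∀ m → List (Vec ℕ (suc m))
enumeration m = filter 𝒲? (words (suc m) (suc m))

∈-enumeration : ∀ {m} {w : Vec ℕ (suc m)} → 𝒲 (suc m) w → w ∈ₗ enumeration m
∈-enumeration {m} {w} Ww@(h , h≤m , height) = ∈-filter⁺ 𝒲?
  (∈-words w (λ k∈ → s≤s (≤-trans (Equivalence.to (height _) k∈) h≤m))) Ww

𝒲-rot : ∀ {m} {w : Vec ℕ (suc m)} → 𝒲 (suc m) w → 𝒲 (suc m) (rot w)
𝒲-rot {w = w} (h , h≤m , height) = h , h≤m , λ k → mk⇔
  (Equivalence.to (height k) ∘ ∈-rot⁻ w) (∈-rot⁺ w ∘ Equivalence.from (height k))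

∈-replicate : ∀ {k} n (x : ℕ) → k ∈ replicate n x → k ≡ x
∈-replicate (suc n) x (VecAny.here eq)  = eq
∈-replicate (suc n) x (VecAny.there k∈) = ∈-replicate n x k∈

𝒲-zeros : ∀ m → 𝒲 (suc m) (replicate (suc m) 0)
𝒲-zeros m = 0 , z≤n , λ k → mk⇔ (≤-reflexive ∘ ∈-replicate (suc m) 0) λ { z≤n → VecAny.here refl }

zeros-unique : ∀ {n} (w : Vec ℕ n) → (∀ {k} → k ∈ w → k ≤ 0) → w ≡ replicate n 0
zeros-unique []      bound = refl
zeros-unique (x ∷ w) bound = cong₂ _∷_ (n≤0⇒n≡0 (bound (VecAny.here refl))) (zeros-unique w (bound ∘ VecAny.there))

-- Zeroing one copy of the greatest letter leaves all smaller letters in place. If another copy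
-- remains in `u`, the height is still `suc h`; otherwise it drops to `h`.
lower-head : ∀ {m h} {u : Vec ℕ m} → suc h ≤ m → HasHeight (suc h ∷ u) (suc h) → 𝒲 (suc m) (0 ∷ u)
lower-head {m} {h} {u} h<m height with suc h ∈? u
... | yes 1+h∈u = suc h , h<m , λ k → mk⇔ to (from k)
  where
  to : ∀ {k} → k ∈ 0 ∷ u → k ≤ suc h
  to (VecAny.here refl) = z≤n
  to (VecAny.there k∈)  = Equivalence.to (height _) (VecAny.there k∈)
  from : ∀ k → k ≤ suc h → k ∈ 0 ∷ u
  from k k≤ with Equivalence.from (height k) k≤
  ... | VecAny.here refl = VecAny.there 1+h∈u
  ... | VecAny.there k∈  = VecAny.there k∈
... | no 1+h∉u = h , <⇒≤ h<m , λ k → mk⇔ to (from k)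
  where
  to : ∀ {k} → k ∈ 0 ∷ u → k ≤ h
  to (VecAny.here refl) = z≤n
  to (VecAny.there k∈)  = m<1+n⇒m≤n (≤∧≢⇒< (Equivalence.to (height _) (VecAny.there k∈))
    λ { refl → 1+h∉u k∈ })
  from : ∀ k → k ≤ h → k ∈ 0 ∷ u
  from k k≤ with Equivalence.from (height k) (m≤n⇒m≤1+n k≤)
  ... | VecAny.here refl = contradiction k≤ 1+n≰n
  ... | VecAny.there k∈  = VecAny.there k∈

-- The universal cycle for `𝒲 (suc m)`.

module _ (m : ℕ) where

  open Orbits (≡-dec ℕ._≟_) (init {n = m}) tail rot init-rot rot-periodic

  zeros : Vec ℕ (suc m)
  zeros = replicate (suc m) 0

  reachable⇒𝒲 : ∀ {w} → Reachable (𝒲 (suc m)) zeros w → 𝒲 (suc m) w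
  reachable⇒𝒲 base          = 𝒲-zeros m
  reachable⇒𝒲 (rotate r)    = 𝒲-rot (reachable⇒𝒲 r)
  reachable⇒𝒲 (branch Ww _ _) = Ww

  -- Strong induction on the letter sum rather than on the height, because zeroing one copy of the
  -- greatest letter always lowers the sum but may leave the height unchanged.
  𝒲⇒reachable : ∀ {w} → 𝒲 (suc m) w → Reachable (𝒲 (suc m)) zeros w
  𝒲⇒reachable Ww = <-rec Q step _ refl Ww
    where
    Q : ℕ → Set
    Q s = ∀ {w} → sum w ≡ s → 𝒲 (suc m) w → Reachable (𝒲 (suc m)) zeros w

    step : ∀ s → (∀ {s′} → s′ < s → Q s′) → Q s
    step s rec {w} _ (zero , _ , height) =
      subst (Reachable _ _) (sym (zeros-unique w (Equivalence.to (height _)))) base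
    step s rec {w} sum≡ (suc h , h<m , height)
      with rotate-to-front w (Equivalence.from (height (suc h)) ≤-refl)
    -- Both `0 ∷ u` and `suc h ∷ u` have tail `u`, so a branch leads from one to the other, and `k`
    -- rotations then give `w`.
    ... | u , k , refl = fold-closed (Reachable _ _) rotate k
            (branch (suc h , h<m , height′) refl (rec smaller refl (lower-head h<m height′)))
      where
      height′ : HasHeight (suc h ∷ u) (suc h)
      height′ l = mk⇔ (Equivalence.to (height l) ∘ ∈-fold-rot⁺ _ k) (∈-fold-rot⁻ _ k ∘ Equivalence.from (height l))

      smaller : sum (0 ∷ u) < s
      smaller = subst (sum u <_) (trans (sym (sum-fold-rot (suc h ∷ u) k)) sum≡) (s≤s (m≤n+m (sum u) h))

  closed-walk-overlap : ∀ {v x xs} → Walk v v (x ∷ xs) → ∀ i →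
    tail (lookup (fromList (x ∷ xs)) i) ≡ init (lookup (fromList (x ∷ xs)) (next i))
  closed-walk-overlap {x = x} {xs} p i with view i
  -- The last index wraps to `zero`, where the overlap holds because the walk ends at the vertex
  -- where it began.
  ... | ‵fromℕ     = trans (walk-last p) (trans (sym (walk-first p))
          (cong (init ∘ lookup (fromList (x ∷ xs))) (sym (next-fromℕ (length xs)))))
  ... | ‵inject₁ j = trans (walk-step p j)
          (cong (init ∘ lookup (fromList (x ∷ xs))) (sym (next-inject₁ j)))

  ucycle : ∃ λ N → ∃ λ (as : Vec ℕ N) → IsUCycle (𝒲 (suc m)) as
  ucycle with covering-trail (𝒲 (suc m)) zeros
    (All.tabulate (λ w∈ → 𝒲⇒reachable (proj₂ (∈-filter⁻ 𝒲? {xs = words (suc m) (suc m)} w∈))))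
  -- The base word lies on the trail, so the cycle has positive length.
  ... | record { edges = []     ; base∈ = () } , _
  ... | record { edges = x ∷ xs ; closed = closed ; unique = unique ; sound = sound } , covers =
    suc (length xs) , Vec.map head (fromList (x ∷ xs)) ,
    ucycle-from-heads (fromList (x ∷ xs)) (fromList-unique unique)
      -- Soundness keeps the trail inside `𝒲 (suc m)`, and coverage of the enumeration makes it
      -- exhaust that set.
      (λ w → mk⇔ (reachable⇒𝒲 ∘ sound ∘ ∈-fromList⁻) (∈-fromList⁺ ∘ All.lookup covers ∘ ∈-enumeration))
      (closed-walk-overlap closed)

theorem3p2 : (n : ℕ) .{{_ : NonZero n}} → ∃ λ (N : ℕ) → ∃ λ (as : Vec ℕ N) → IsUCycle (𝒲 n) as
theorem3p2 (suc m) = ucycle m
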